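{- Let $k\ge 6$ and $g=2d\ge 6$, and let $G$ be a $(k,g)$-graph of excess $4$ with adjacency matrix $A$ and excess matrix $E$. If $\mu\neq\pm k$ is an eigenvalue of $A$, then $$H_{d-1}(\mu)=-\lambda$$ for some eigenvalue $\lambda$ of $E$.
   Context: Graphs are finite and simple. A $(k,g)$-graph is a $k$-regular graph of girth $g$. For even $g=2d$ the Moore bound is $M(k,g)=2\bigl(1+(k-1)+\dots+(k-1)^{d-1}\bigr)$, and the excess of a $(k,g)$-graph of order $n$ is $n-M(k,g)$. For $k\ge 6$ and $g=2d\ge 6$, a $(k,g)$-graph $G$ of excess $4$ is bipartite of diameter $d+1$ (known theorem of Biggs and Ito). The excess matrix $E$ of $G$ is the $n\times n$ matrix indexed by the vertices of $G$ with $E_{u,v}=1$ if the distance $d(u,v)$ in $G$ equals $d+1$, and $E_{u,v}=0$ otherwise. The polynomials $H_i(x)$ are defined by $H_0(x)=1$, $H_1(x)=x$, and $H_{i+1}(x)=xH_i(x)-(k-1)H_{i-1}(x)$ for $i\ge 1$. -}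

module Defs where

open import Algebra.Apartness.Bundles using (HeytingCommutativeRing; HeytingField)
open import Algebra.Bundles using (CommutativeRing)
import Algebra.Properties.Semiring.Mult as Mult
import Algebra.Properties.Semiring.Sum as Sum
open import Data.Bool.Base using (if_then_else_)
open import Data.Fin.Base using (Fin; toℕ)
open import Data.Fin.Properties using (any?; _≟_)
open import Data.Integer.Base using (ℤ; _⊖_)
open import Data.List.Base using (length; filter; allFin)
open import Data.Nat.Base as ℕ using (ℕ; zero; suc)
open import Data.Nat.Properties using (allUpTo?)
open import Data.Product.Base using (_×_; ∃; ∃-syntax)
open import Data.Vec.Functional using (Vector)
open import Function.Definitions using (Injective)
open import Level using (Level; 0ℓ; _⊔_)
open import Relation.Binary.Core using (Rel)
open import Relation.Binary.Definitions using (Decidable; Symmetric)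
open import Relation.Binary.PropositionalEquality.Core using (_≡_)
open import Relation.Nullary.Decidable using (Dec; does; _×-dec_; ¬?)
open import Relation.Nullary.Negation using (¬_)

record SimpleGraph (n : ℕ) : Set₁ where
  infix 4 _~_ _~?_
  field
    _~_      : Rel (Fin n) 0ℓ
    _~?_     : Decidable _~_
    ~-sym    : Symmetric _~_
    ~-irrefl : ∀ v → ¬ (v ~ v)

module _ {n : ℕ} (G : SimpleGraph n) where
  open SimpleGraph G

  degree : Fin n → ℕ
  degree v = length (filter (v ~?_) (allFin n))

  Regular : ℕ → Set
  Regular k = ∀ v → degree v ≡ k

  record Cycle (m : ℕ) : Set where
    field
      3≤length  : 3 ℕ.≤ m
      vertex    : Fin m → Fin n
      injective : Injective _≡_ _≡_ vertex
      step      : ∀ i j → suc (toℕ i) ≡ toℕ j → vertex i ~ vertex j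
      close     : ∀ i j → suc (toℕ i) ≡ m → toℕ j ≡ 0 → vertex i ~ vertex j

  HasGirth : ℕ → Set
  HasGirth g = Cycle g × (∀ m → m ℕ.< g → ¬ Cycle m)

  record IsRegularOfGirth (k g : ℕ) : Set where
    field
      regular : Regular k
      girth   : HasGirth g

  Walk : ℕ → Fin n → Fin n → Set
  Walk zero    u v = u ≡ v
  Walk (suc m) u v = ∃[ w ] (u ~ w × Walk m w v)

  -- Distance m u v says d(u,v) = m; it holds for no m when u and v lie in
  -- different components.
  Distance : ℕ → Fin n → Fin n → Set
  Distance m u v = Walk m u v × (∀ {j} → j ℕ.< m → ¬ Walk j u v)

  walk? : ∀ m → Decidable (Walk m)
  walk? zero    u v = u ≟ v
  walk? (suc m) u v = any? λ w → (u ~? w) ×-dec walk? m w v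

  distance? : ∀ m → Decidable (Distance m)
  distance? m u v = walk? m u v ×-dec allUpTo? (λ j → ¬? (walk? j u v)) m

geometricSum : ℕ → ℕ → ℕ
geometricSum q zero    = 0
geometricSum q (suc i) = geometricSum q i ℕ.+ q ℕ.^ i

-- The bound for girth 2d, as a function of k and d.
evenMooreBound : ℕ → ℕ → ℕ
evenMooreBound k d = 2 ℕ.* geometricSum (k ℕ.∸ 1) d

-- _⊖_ is the untruncated difference of naturals.
evenExcess : ℕ → ℕ → ℕ → ℤ
evenExcess k d n = n ⊖ evenMooreBound k d

-- Scalars live in a field F.  As the standard library has no real numbers, F
-- is any Heyting field of characteristic zero, ℝ and ℂ being instances.
module _ {c ℓ₁ ℓ₂ : Level} (F : HeytingField c ℓ₁ ℓ₂) where
  open HeytingField F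
  open CommutativeRing (HeytingCommutativeRing.commutativeRing heytingCommutativeRing)
    using (semiring)
  open Mult semiring using () renaming (_×_ to _·_)
  open Sum semiring using (sum)

  natural : ℕ → Carrier
  natural m = m · 1#

  CharacteristicZero : Set ℓ₂
  CharacteristicZero = ∀ m → natural (suc m) # 0#

  Matrix : ℕ → Set c
  Matrix n = Fin n → Fin n → Carrier

  -- A nonzero vector has a coordinate apart from zero; over a field with
  -- decidable equality this is the usual v ≠ 0.
  IsEigenvalue : ∀ {n} → Matrix n → Carrier → Set (c ⊔ ℓ₁ ⊔ ℓ₂)
  IsEigenvalue {n} M μ = ∃ λ (v : Vector Carrier n) →
    (∃[ i ] (v i # 0#)) × (∀ i → sum (λ j → M i j * v j) ≈ μ * v i)

  indicator : ∀ {p} {P : Set p} → Dec P → Carrier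
  indicator P? = if does P? then 1# else 0#

  adjacencyMatrix : ∀ {n} → SimpleGraph n → Matrix n
  adjacencyMatrix G u v = indicator (SimpleGraph._~?_ G u v)

  excessMatrix : ∀ {n} → SimpleGraph n → ℕ → Matrix n
  excessMatrix G d u v = indicator (distance? G (suc d) u v)

  H : ℕ → ℕ → Carrier → Carrier
  H k zero          x = 1#
  H k (suc zero)    x = x
  H k (suc (suc i)) x = x * H k (suc i) x - (natural k - 1#) * H k i x

{-# OPTIONS --safe #-}
-- For m < d the matrix H_m(A) is the indicator of "there is a walk of length
-- m", because the girth is 2d.  Excess 4 says that for every edge xy exactly
-- four vertices are at distance ≥ d from both x and y.  This forces, for every
-- vertex u, that exactly one end of each edge is joined to u by a walk of
-- length d: if neither end of yy′ were, then all k > 4 neighbours of u would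
-- be far from yy′; if both were, then near y and y′ one finds k - 1 > 4
-- vertices far from an edge ux.  So G is properly 2-coloured, the colour class
-- without walks of length d from u is the row of H_{d-1}(A) + E at u, and the
-- coordinates of a μ-eigenvector with μ ≠ ±k sum to zero on it.  Hence the same
-- vector is an eigenvector of E for -H_{d-1}(μ).
module Submission where

open import Defs
open import Algebra.Apartness.Bundles using (HeytingField; HeytingCommutativeRing)
open import Data.Integer.Base using (+_; _⊖_)
open import Data.Nat.Base using (ℕ; _≤_; _∸_) renaming (_*_ to _*ℕ_)
open import Data.Product.Base using (_×_; ∃-syntax)
open import Relation.Binary.PropositionalEquality.Core using (_≡_)
open import Relation.Nullary.Negation using (¬_)

open import Algebra.Bundles using (CommutativeRing; CommutativeSemiring)
import Algebra.Properties.Semiring.Mult as Mult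
import Algebra.Properties.Semiring.Sum as Sum
import Data.Integer.Properties as ℤ
open import Data.Bool.Base using (if_then_else_)
open import Data.Empty using (⊥; ⊥-elim)
open import Data.Fin.Base using (Fin; zero; suc; toℕ)
open import Data.Fin.Properties using (any?; _≟_; toℕ<n; toℕ-injective; 0≢1+n; suc-injective)
open import Data.List.Base using (length; filter; tabulate)
open import Data.Nat.Base using (zero; suc; _<_; _+_; _^_; z≤n; s≤s)
open import Data.Nat.Properties as ℕ using (module ≤-Reasoning)
open import Data.Product.Base using (∃; _,_; proj₁; proj₂)
open import Data.Sum.Base using (_⊎_; inj₁; inj₂; [_,_]′)
open import Data.Unit.Base using (tt)
open import Function.Base using (_∘_; id)
open import Level using (0ℓ)
open import Relation.Binary.Definitions using (tri<; tri≈; tri>)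
open import Relation.Binary.PropositionalEquality
  using (refl; sym; trans; cong; cong₂; subst; _≢_; module ≡-Reasoning)
open import Relation.Nullary.Decidable using (Dec; yes; no; does; _×-dec_; _⊎-dec_; ¬?)
open import Relation.Nullary.Negation using (contradiction)
open import Relation.Unary using (Pred; Decidable)

open Sum ℕ.+-*-semiring using (sum; sum-cong-≗; ∑-comm; ∑-distrib-+; *-distribˡ-sum)

-- Counting

private variable
  P Q R : Set

⟦_⟧ : Dec P → ℕ
⟦ P? ⟧ = if does P? then 1 else 0

⟦⟧-true : (P? : Dec P) → P → ⟦ P? ⟧ ≡ 1
⟦⟧-true (yes _) _ = refl
⟦⟧-true (no ¬p) p = contradiction p ¬p

⟦⟧-false : (P? : Dec P) → ¬ P → ⟦ P? ⟧ ≡ 0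
⟦⟧-false (yes p) ¬p = contradiction p ¬p
⟦⟧-false (no _)  _  = refl

⟦⟧-mono : (P? : Dec P) (Q? : Dec Q) → (P → Q) → ⟦ P? ⟧ ≤ ⟦ Q? ⟧
⟦⟧-mono (yes p) Q? f = ℕ.≤-reflexive (sym (⟦⟧-true Q? (f p)))
⟦⟧-mono (no _)  _  _ = z≤n

⟦⟧-cong : (P? : Dec P) (Q? : Dec Q) → (P → Q) → (Q → P) → ⟦ P? ⟧ ≡ ⟦ Q? ⟧
⟦⟧-cong P? Q? f g = ℕ.≤-antisym (⟦⟧-mono P? Q? f) (⟦⟧-mono Q? P? g)

⟦⟧-× : (P? : Dec P) (Q? : Dec Q) → ⟦ P? ×-dec Q? ⟧ ≡ ⟦ P? ⟧ *ℕ ⟦ Q? ⟧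
⟦⟧-× (yes _) (yes _) = refl
⟦⟧-× (yes _) (no _)  = refl
⟦⟧-× (no _)  _       = refl

⟦⟧-split : (P? : Dec P) (Q? : Dec Q) →
           ⟦ P? ⟧ ≡ ⟦ P? ×-dec Q? ⟧ + ⟦ P? ×-dec ¬? Q? ⟧
⟦⟧-split (yes _) (yes _) = refl
⟦⟧-split (yes _) (no _)  = refl
⟦⟧-split (no _)  _       = refl

sum-mono : ∀ {n} (f g : Fin n → ℕ) → (∀ i → f i ≤ g i) → sum f ≤ sum g
sum-mono {zero}  f g f≤g = z≤n
sum-mono {suc n} f g f≤g =
  ℕ.+-mono-≤ (f≤g zero) (sum-mono (f ∘ suc) (g ∘ suc) (f≤g ∘ suc))

count : ∀ {n} {P : Pred (Fin n) 0ℓ} → Decidable P → ℕ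
count P? = sum λ i → ⟦ P? i ⟧

-- Turns `degree` into a `count`. The list is `tabulate f` rather than `allFin`, which is
-- `tabulate id`, so that the induction can pass to `f ∘ suc`.
length-filter : ∀ {a n} {A : Set a} {P : Pred A 0ℓ} (P? : Decidable P) (f : Fin n → A) →
                length (filter P? (tabulate f)) ≡ count (P? ∘ f)
length-filter {n = zero}  P? f = refl
length-filter {n = suc n} P? f with P? (f zero)
... | yes _ = cong suc (length-filter P? (f ∘ suc))
... | no  _ = length-filter P? (f ∘ suc)

module _ {n} {P Q : Pred (Fin n) 0ℓ} (P? : Decidable P) (Q? : Decidable Q) where

  count-mono : (∀ i → P i → Q i) → count P? ≤ count Q?
  count-mono P⊆Q = sum-mono _ _ λ i → ⟦⟧-mono (P? i) (Q? i) (P⊆Q i)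

  count-cong : (∀ i → P i → Q i) → (∀ i → Q i → P i) → count P? ≡ count Q?
  count-cong P⊆Q Q⊆P = sum-cong-≗ λ i → ⟦⟧-cong (P? i) (Q? i) (P⊆Q i) (Q⊆P i)

  count-split : count P? ≡ count (λ i → P? i ×-dec Q? i) + count (λ i → P? i ×-dec ¬? (Q? i))
  count-split = trans (sum-cong-≗ λ i → ⟦⟧-split (P? i) (Q? i)) (∑-distrib-+ {n} _ _)

count-none : ∀ {n} {P : Pred (Fin n) 0ℓ} (P? : Decidable P) → (∀ i → ¬ P i) → count P? ≡ 0
count-none {zero}  P? ¬P = refl
count-none {suc n} P? ¬P =
  cong₂ _+_ (⟦⟧-false (P? zero) (¬P zero)) (count-none (P? ∘ suc) (¬P ∘ suc))

count-all : ∀ {n} {P : Pred (Fin n) 0ℓ} (P? : Decidable P) → (∀ i → P i) → count P? ≡ n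
count-all {zero}  P? all = refl
count-all {suc n} P? all =
  cong₂ _+_ (⟦⟧-true (P? zero) (all zero)) (count-all (P? ∘ suc) (all ∘ suc))

count-one : ∀ {n} {P : Pred (Fin n) 0ℓ} (P? : Decidable P) i → P i → (∀ j → P j → j ≡ i) →
            count P? ≡ 1
count-one P? zero pᵢ unique = cong₂ _+_ (⟦⟧-true (P? zero) pᵢ)
  (count-none (P? ∘ suc) λ j pⱼ → 0≢1+n (sym (unique (suc j) pⱼ)))
count-one P? (suc i) pᵢ unique = cong₂ _+_
  (⟦⟧-false (P? zero) λ p₀ → 0≢1+n (unique zero p₀))
  (count-one (P? ∘ suc) i pᵢ λ j pⱼ → suc-injective (unique (suc j) pⱼ))

count-≤1 : ∀ {n} {P : Pred (Fin n) 0ℓ} (P? : Decidable P) → (∀ i j → P i → P j → i ≡ j) →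
           count P? ≤ 1
count-≤1 P? unique with any? P?
... | yes (i , pᵢ) = ℕ.≤-reflexive (count-one P? i pᵢ λ j pⱼ → unique j i pⱼ pᵢ)
... | no  ¬∃       = ℕ.≤-trans (ℕ.≤-reflexive (count-none P? λ i pᵢ → ¬∃ (i , pᵢ))) z≤n

count-≥1 : ∀ {n} {P : Pred (Fin n) 0ℓ} (P? : Decidable P) i → P i → 1 ≤ count P?
count-≥1 P? i pᵢ = ℕ.≤-trans
  (ℕ.≤-reflexive (sym (count-one (_≟ i) i refl λ _ → id)))
  (count-mono (_≟ i) P? λ { _ refl → pᵢ })

count-∃ : ∀ {n} {P : Pred (Fin n) 0ℓ} (P? : Decidable P) → 1 ≤ count P? → ∃ P
count-∃ P? 1≤ with any? P?
... | yes ∃p = ∃p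
... | no  ¬∃ = contradiction (subst (1 ≤_) (count-none P? λ i pᵢ → ¬∃ (i , pᵢ)) 1≤) λ ()

count-∃≢ : ∀ {n} {P : Pred (Fin n) 0ℓ} (P? : Decidable P) → 2 ≤ count P? →
           ∀ j → ∃ λ i → P i × i ≢ j
count-∃≢ P? 2≤ j with any? (λ i → P? i ×-dec ¬? (i ≟ j))
... | yes found = found
... | no  ¬∃    = contradiction (ℕ.≤-trans 2≤ (count-≤1 P? λ a b pa pb → trans (only a pa) (sym (only b pb)))) λ { (s≤s ()) }
  where
  only : ∀ i → _ → i ≡ j
  only i pᵢ with i ≟ j
  ... | yes i≡j = i≡j
  ... | no  i≢j = contradiction (i , pᵢ , i≢j) ¬∃

-- Double counting of the pairs related by `R`: each counted i lies in at least one pair, each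
-- counted j in at most one.
count-inject : ∀ {m n} {P : Pred (Fin m) 0ℓ} {Q : Pred (Fin n) 0ℓ} {R : Fin m → Fin n → Set}
               (P? : Decidable P) (Q? : Decidable Q) (R? : ∀ i j → Dec (R i j)) →
               (∀ i → P i → ∃ λ j → Q j × R i j) →
               (∀ i i′ j → P i → P i′ → Q j → R i j → R i′ j → i ≡ i′) →
               count P? ≤ count Q?
count-inject {m} {n} P? Q? R? total injective = begin
  count P?                           ≤⟨ sum-mono _ _ row ⟩
  sum (λ i → count (S? i))           ≡⟨ ∑-comm {m} {n} (λ i j → ⟦ S? i j ⟧) ⟩
  sum (λ j → count (λ i → S? i j))   ≤⟨ sum-mono _ _ column ⟩
  count Q?                           ∎
  where
  open ≤-Reasoning
  S? : ∀ i j → Dec _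
  S? i j = P? i ×-dec Q? j ×-dec R? i j
  row : ∀ i → ⟦ P? i ⟧ ≤ count (S? i)
  row i with P? i
  ... | no _  = z≤n
  ... | yes pᵢ = let j , qⱼ , r = total i pᵢ in
    count-≥1 (λ j → yes pᵢ ×-dec Q? j ×-dec R? i j) j (pᵢ , qⱼ , r)
  column : ∀ j → count (λ i → S? i j) ≤ ⟦ Q? j ⟧
  column j with Q? j
  ... | yes qⱼ = count-≤1 (λ i → P? i ×-dec yes qⱼ ×-dec R? i j)
    λ { i i′ (pᵢ , _ , r) (pᵢ′ , _ , r′) → injective i i′ j pᵢ pᵢ′ qⱼ r r′ }
  ... | no ¬qⱼ = ℕ.≤-reflexive
    (count-none (λ i → P? i ×-dec no ¬qⱼ ×-dec R? i j) λ { i (_ , qⱼ , _) → ¬qⱼ qⱼ })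

count-complement : ∀ {n} {P : Pred (Fin n) 0ℓ} (P? : Decidable P) →
                   n ≡ count P? + count (λ i → ¬? (P? i))
count-complement P? =
  trans (sym (count-all (λ _ → yes tt) _)) (count-split (λ _ → yes tt) P?)

-- Walks

module _ {n} (G : SimpleGraph n) where
  open SimpleGraph G

  walk-snoc : ∀ m {u v w} → Walk G m u v → v ~ w → Walk G (suc m) u w
  walk-snoc zero    refl          v~w = _ , v~w , refl
  walk-snoc (suc m) (a , u~a , p) v~w = a , u~a , walk-snoc m p v~w

  walk-sym : ∀ m {u v} → Walk G m u v → Walk G m v u
  walk-sym zero    refl          = refl
  walk-sym (suc m) (a , u~a , p) = walk-snoc m (walk-sym m p) (~-sym u~a)

  walk-++ : ∀ l {m u v w} → Walk G l u v → Walk G m v w → Walk G (l + m) u w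
  walk-++ zero    refl          r = r
  walk-++ (suc l) (a , u~a , p) r = a , u~a , walk-++ l p r

  walk-unsnoc : ∀ m {u v} → Walk G (suc m) u v → ∃ λ w → v ~ w × Walk G m u w
  walk-unsnoc m p = let w , v~w , r = walk-sym (suc m) p in w , v~w , walk-sym m r

  -- Walks of length m - 1, of which there are none for m = 0. This lets two-term recurrences start
  -- at m = 0.
  ShorterWalk : ℕ → Fin n → Fin n → Set
  ShorterWalk zero    u v = ⊥
  ShorterWalk (suc m) u v = Walk G m u v

  shorterWalk? : ∀ m u v → Dec (ShorterWalk m u v)
  shorterWalk? zero    u v = no id
  shorterWalk? (suc m) u v = walk? G m u v

  shorterWalk-sym : ∀ m {u v} → ShorterWalk m u v → ShorterWalk m v u
  shorterWalk-sym zero    ()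
  shorterWalk-sym (suc m) = walk-sym m

  -- Trail m u a v: a non-backtracking walk of length suc m from u to v with
  -- second vertex a.
  infixr 5 _∷⟨_⟩_
  data Trail : ℕ → Fin n → Fin n → Fin n → Set where
    [_]     : ∀ {u v} → u ~ v → Trail 0 u v v
    _∷⟨_⟩_ : ∀ {m u a b v} → u ~ a → u ≢ b → Trail m a b v → Trail (suc m) u a v

  -- If the walk returns to u after two steps, cutting off these steps leaves a walk shorter by two;
  -- likewise if the tail can be shortened.
  reduce : ∀ m {u a v} → u ~ a → Walk G m a v → Trail m u a v ⊎ ShorterWalk m u v
  reduce zero    u~a refl = inj₁ [ u~a ]
  reduce (suc m) {u} u~a (b , a~b , p) with reduce m a~b p
  reduce (suc m)       {u} u~a (b , a~b , p) | inj₁ t with u ≟ b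
  ... | yes refl = inj₂ p
  ... | no  u≢b  = inj₁ (u~a ∷⟨ u≢b ⟩ t)
  -- The tail has index at least 1 here, since `ShorterWalk 0` is empty.
  reduce (suc (suc m)) {u} u~a (b , a~b , p) | inj₂ r = inj₂ (_ , u~a , r)

  -- Two trails leaving u through different edges: reverse the first and
  -- append the second.
  join : ∀ {l m u a b v w} → Trail l u a v → Trail m u b w → a ≢ b →
         ∃ λ c → Trail (suc (l + m)) v c w
  join [ u~v ] t a≢b = _ , ~-sym u~v ∷⟨ a≢b ⟩ t
  join {suc l} {m} {v = v} {w = w} (u~a ∷⟨ u≢a′ ⟩ s) t a≢b =
    let c , r = join s (~-sym u~a ∷⟨ a≢b ⟩ t) (u≢a′ ∘ sym) in
    c , subst (λ i → Trail (suc i) v c w) (ℕ.+-suc l m) r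

  -- Positions past the end repeat the last vertex, so positions can be plain naturals.
  vertex : ∀ {m u a v} → Trail m u a v → ℕ → Fin n
  vertex {u = u} _       zero    = u
  vertex {v = v} [ _ ]   (suc _) = v
  vertex (_ ∷⟨ _ ⟩ t) (suc i) = vertex t i

  vertex-1 : ∀ {m u a v} (t : Trail m u a v) → vertex t 1 ≡ a
  vertex-1 [ _ ]                  = refl
  vertex-1 (_ ∷⟨ _ ⟩ [ _ ])       = refl
  vertex-1 (_ ∷⟨ _ ⟩ _ ∷⟨ _ ⟩ _)  = refl

  vertex-last : ∀ {m u a v} (t : Trail m u a v) → vertex t (suc m) ≡ v
  vertex-last [ _ ]         = refl
  vertex-last (_ ∷⟨ _ ⟩ t) = vertex-last t

  vertex-~ : ∀ {m u a v} (t : Trail m u a v) i → i ≤ m → vertex t i ~ vertex t (suc i)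
  vertex-~ [ u~v ]         zero    _         = u~v
  vertex-~ (u~a ∷⟨ _ ⟩ t) zero    _         = u~a
  vertex-~ (_ ∷⟨ _ ⟩ t)   (suc i) (s≤s i≤m) = vertex-~ t i i≤m

  Distinct : ∀ {m u a v} → Trail m u a v → Set
  Distinct {m} t = ∀ i j → i < j → j ≤ suc m → vertex t i ≢ vertex t j

  -- By induction on the tail. If the tail has distinct vertices but meets u again, its initial part
  -- up to that place is closed to a cycle by the first edge.
  distinct-or-cycle : ∀ {m u a v} (t : Trail m u a v) →
                      Distinct t ⊎ ∃ λ l → l ≤ suc m × Cycle G l
  distinct-or-cycle [ u~v ] = inj₁ λ where
    zero    (suc _) _         _          refl → ~-irrefl _ u~v
    (suc _) (suc _) (s≤s i<j) (s≤s z≤n) → contradiction i<j λ ()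
  distinct-or-cycle {suc m} {u} (u~a ∷⟨ u≢b ⟩ t) with distinct-or-cycle t
  ... | inj₂ (l , l≤ , c) = inj₂ (l , ℕ.m≤n⇒m≤1+n l≤ , c)
  ... | inj₁ distinct with ℕ.anyUpTo? (λ j → vertex t j ≟ u) (suc (suc m))
  ...   | no ¬hit = inj₁ λ where
    zero    (suc j) _         (s≤s j≤) eq → ¬hit (j , s≤s j≤ , sym eq)
    (suc i) (suc j) (s≤s i<j) (s≤s j≤) eq → distinct i j i<j j≤ eq
  ...   | yes (zero , _ , eq) = contradiction (subst (u ~_) eq u~a) (~-irrefl u)
  ...   | yes (suc zero , _ , eq) = contradiction (trans (sym eq) (vertex-1 t)) u≢b
  -- The return to u is at position j ≥ 2 of the tail: position 0 is excluded by irreflexivity,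
  -- position 1 by the absence of backtracking. The cycle has the j + 1 vertices at positions 0 to
  -- j.
  ...   | yes (suc (suc i) , s≤s j≤ , eq) = inj₂ (suc j , s≤s j≤ , record
    { 3≤length  = s≤s (s≤s (s≤s z≤n))
    ; vertex    = vertex t ∘ toℕ
    ; injective = λ {x} {y} → injective x y
    ; step      = λ x y x+1≡y → subst (λ i → vertex t (toℕ x) ~ vertex t i) x+1≡y
        (vertex-~ t (toℕ x) (ℕ.≤-pred (ℕ.≤-trans (subst (_≤ j) (sym x+1≡y) (ℕ.≤-pred (toℕ<n y))) j≤)))
    ; close     = λ x y x+1≡m y≡0 →
        subst (λ v → vertex t (toℕ x) ~ v) (cong (vertex t) (sym y≡0))
          (subst (_~ vertex t 0) (trans (sym eq) (cong (vertex t) (sym (ℕ.suc-injective x+1≡m)))) u~a)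
    })
    where
    j = suc (suc i)
    bound : (x : Fin (suc j)) → toℕ x ≤ suc m
    bound x = ℕ.≤-trans (ℕ.≤-pred (toℕ<n x)) j≤
    injective : (x y : Fin (suc j)) → vertex t (toℕ x) ≡ vertex t (toℕ y) → x ≡ y
    injective x y e with ℕ.<-cmp (toℕ x) (toℕ y)
    ... | tri< x<y _ _ = contradiction e (distinct _ _ x<y (bound y))
    ... | tri≈ _ x≡y _ = toℕ-injective x≡y
    ... | tri> _ _ y<x = contradiction (sym e) (distinct _ _ y<x (bound x))

-- Consequences of girth at least 2(D+1)

module Girth {n} (G : SimpleGraph n) (D : ℕ) (acyclic : ∀ {m} → m ≤ suc (D + D) → ¬ Cycle G m) where
  open SimpleGraph G

  no-closed-trail : ∀ {m u a} → m ≤ D + D → ¬ Trail G m u a u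
  no-closed-trail {m} m≤ t with distinct-or-cycle G t
  ... | inj₁ distinct     = distinct 0 (suc m) (s≤s z≤n) ℕ.≤-refl (sym (vertex-last G t))
  ... | inj₂ (l , l≤ , c) = acyclic (ℕ.≤-trans l≤ (s≤s m≤)) c

  -- Shortening by two keeps the length odd, so the descent must end in a closed trail of length at
  -- most 2D + 1.
  no-odd-closed-walk : ∀ i {u} → i ≤ D → ¬ Walk G (suc (i + i)) u u
  no-odd-closed-walk i {u} i≤D (a , u~a , p) with reduce G (i + i) u~a p
  ... | inj₁ t = no-closed-trail (ℕ.+-mono-≤ i≤D i≤D) t
  no-odd-closed-walk (suc i) {u} i<D _ | inj₂ r =
    no-odd-closed-walk i (ℕ.<⇒≤ i<D) (subst (λ m → Walk G m u u) (ℕ.+-suc i i) r)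

  -- The two walks and the edge vw would close up to a walk of length 2m + 1. Up to length D this
  -- replaces bipartiteness, which is not known yet.
  not-equidistant : ∀ m {u v w} → m ≤ D → v ~ w → Walk G m u v → ¬ Walk G m u w
  not-equidistant m m≤D v~w p r =
    no-odd-closed-walk m m≤D (_ , v~w , walk-++ G m (walk-sym G m r) p)

  no-triangle : 1 ≤ D → ∀ {u v w} → u ~ v → u ~ w → ¬ v ~ w
  no-triangle 1≤D u~v u~w v~w = not-equidistant 1 1≤D v~w (_ , u~v , refl) (_ , u~w , refl)

  walk-parity : ∀ {u v} → Walk G (suc D) u v → ¬ Walk G D u v
  walk-parity p r = let w , v~w , p′ = walk-unsnoc G D p in not-equidistant D ℕ.≤-refl v~w r p′

  -- If neither walk can be shortened, both are trails from u to w with different first edges, and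
  -- joining them gives a closed trail of length 2m + 2 ≤ 2D.
  fork : ∀ m {u a b w} → m < D → u ~ a → u ~ b → a ≢ b →
         Walk G m a w → Walk G m b w → ShorterWalk G m u w
  fork m m<D u~a u~b a≢b p r with reduce G m u~a p | reduce G m u~b r
  ... | inj₂ s | _      = s
  ... | inj₁ _ | inj₂ s = s
  ... | inj₁ s | inj₁ t = contradiction (proj₂ (join G s t a≢b))
    (no-closed-trail (ℕ.+-mono-≤ m<D (ℕ.<⇒≤ m<D)))

  no-square : 2 ≤ D → ∀ {u v a b} → u ~ a → u ~ b → a ≢ b → v ~ a → v ~ b → u ≡ v
  no-square 2≤D u~a u~b a≢b v~a v~b =
    fork 1 2≤D u~a u~b a≢b (_ , ~-sym v~a , refl) (_ , ~-sym v~b , refl)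

-- Regular graphs of valency 1+q

module Regularity {n} (G : SimpleGraph n) (q D : ℕ)
  (regular : Regular G (suc q)) (acyclic : ∀ {m} → m ≤ suc (D + D) → ¬ Cycle G m) where
  open SimpleGraph G
  open Girth G D acyclic

  valency : ∀ v → count (v ~?_) ≡ suc q
  valency v = trans (sym (length-filter (v ~?_) id)) (regular v)

  neighbour : ∀ v → ∃ (v ~_)
  neighbour v = count-∃ (v ~?_) (subst (1 ≤_) (sym (valency v)) (s≤s z≤n))

  walk-extend : ∀ m {u v} → Walk G m u v → Walk G (2 + m) u v
  walk-extend m {u} p = let a , u~a = neighbour u in a , u~a , u , ~-sym u~a , p

  -- Walks grow by two steps at a time, so parity decides which of the two consecutive lengths is
  -- attained.
  walk-lengthen : ∀ i m {u v} → Walk G m u v → Walk G (i + m) u v ⊎ Walk G (suc (i + m)) u v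
  walk-lengthen zero    m p = inj₁ p
  walk-lengthen (suc i) m p with walk-lengthen i m p
  ... | inj₁ r = inj₂ (walk-extend (i + m) r)
  ... | inj₂ r = inj₁ r

  -- Entry (u, w) of the matrix product W_m A, where W_m is the 0/1 matrix of `Walk G m` and A the
  -- adjacency matrix.
  branches : ℕ → Fin n → Fin n → ℕ
  branches m u w = count λ x → (w ~? x) ×-dec walk? G m u x

  -- In matrix form W_m A = W_{m+1} + q W_{m-1}, the recurrence of `H`. If w is reached in m - 1
  -- steps, all its q + 1 neighbours count; otherwise `fork` allows at most one.
  branches-recurrence : ∀ m u w → m < D →
    branches m u w ≡ ⟦ walk? G (suc m) u w ⟧ + q *ℕ ⟦ shorterWalk? G m u w ⟧
  branches-recurrence m u w m<D with shorterWalk? G m u w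
  branches-recurrence (suc m) u w m<D | yes p = begin
    branches (suc m) u w
      ≡⟨ count-cong (λ x → (w ~? x) ×-dec walk? G (suc m) u x) (w ~?_) (λ _ → proj₁) (λ x w~x → w~x , walk-snoc G m p w~x) ⟩
    count (w ~?_)                              ≡⟨ valency w ⟩
    1 + q                                      ≡⟨ cong₂ _+_ (sym (⟦⟧-true (walk? G (suc (suc m)) u w) (walk-extend m p))) (sym (ℕ.*-identityʳ q)) ⟩
    ⟦ walk? G (suc (suc m)) u w ⟧ + q *ℕ 1 ∎
    where open ≡-Reasoning
  branches-recurrence m u w m<D | no ¬p = trans one-or-none
    (sym (trans (cong (λ x → ⟦ walk? G (suc m) u w ⟧ + x) (ℕ.*-zeroʳ q)) (ℕ.+-identityʳ _)))
    where
    one-or-none : branches m u w ≡ ⟦ walk? G (suc m) u w ⟧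
    one-or-none with walk? G (suc m) u w
    ... | no ¬r = count-none (λ x → (w ~? x) ×-dec walk? G m u x)
      λ x (w~x , p) → ¬r (walk-snoc G m p (~-sym w~x))
    ... | yes r = let x , w~x , p = walk-unsnoc G m r in
      count-one (λ x → (w ~? x) ×-dec walk? G m u x) x (w~x , p) λ y (w~y , p′) → unique x y w~x w~y p p′
      where
      unique : ∀ x y → w ~ x → w ~ y → Walk G m u x → Walk G m u y → y ≡ x
      unique x y w~x w~y p p′ with y ≟ x
      ... | yes y≡x = y≡x
      ... | no  y≢x = contradiction
        (shorterWalk-sym G m (fork m m<D w~y w~x y≢x (walk-sym G m p′) (walk-sym G m p))) ¬p

  branches-sym-< : ∀ m u w → m < D → branches m u w ≡ branches m w u
  branches-sym-< m u w m<D = begin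
    branches m u w                                                ≡⟨ branches-recurrence m u w m<D ⟩
    ⟦ walk? G (suc m) u w ⟧ + q *ℕ ⟦ shorterWalk? G m u w ⟧
      ≡⟨ cong₂ (λ x y → x + q *ℕ y)
           (⟦⟧-cong (walk? G (suc m) u w) (walk? G (suc m) w u) (walk-sym G (suc m)) (walk-sym G (suc m)))
           (⟦⟧-cong (shorterWalk? G m u w) (shorterWalk? G m w u) (shorterWalk-sym G m) (shorterWalk-sym G m)) ⟩
    ⟦ walk? G (suc m) w u ⟧ + q *ℕ ⟦ shorterWalk? G m w u ⟧  ≡⟨ branches-recurrence m w u m<D ⟨
    branches m w u                                                ∎
    where open ≡-Reasoning

  -- Entry (u, w) of A W_m A.
  neighbour-pairs : ℕ → Fin n → Fin n → ℕ
  neighbour-pairs m u w = sum λ x → ⟦ u ~? x ⟧ *ℕ branches m x w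

  neighbour-pairs-sym : ∀ m u w → neighbour-pairs m u w ≡ neighbour-pairs m w u
  neighbour-pairs-sym m u w = begin
    neighbour-pairs m u w               ≡⟨ sum-cong-≗ (λ x → *-distribˡ-sum {n} ⟦ u ~? x ⟧ _) ⟩
    sum (λ x → sum λ y → pair u w x y)  ≡⟨ ∑-comm {n} {n} (pair u w) ⟩
    sum (λ y → sum λ x → pair u w x y)  ≡⟨ sum-cong-≗ (λ y → sum-cong-≗ λ x → swap x y) ⟩
    sum (λ y → sum λ x → pair w u y x)  ≡⟨ sum-cong-≗ (λ y → *-distribˡ-sum {n} ⟦ w ~? y ⟧ _) ⟨
    neighbour-pairs m w u               ∎
    where
    open ≡-Reasoning
    pair : Fin n → Fin n → Fin n → Fin n → ℕ
    pair u w x y = ⟦ u ~? x ⟧ *ℕ ⟦ (w ~? y) ×-dec walk? G m x y ⟧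
    swap : ∀ x y → pair u w x y ≡ pair w u y x
    swap x y = begin
      pair u w x y ≡⟨ ⟦⟧-× (u ~? x) ((w ~? y) ×-dec walk? G m x y) ⟨
      ⟦ (u ~? x) ×-dec (w ~? y) ×-dec walk? G m x y ⟧
        ≡⟨ ⟦⟧-cong ((u ~? x) ×-dec (w ~? y) ×-dec walk? G m x y)
                   ((w ~? y) ×-dec (u ~? x) ×-dec walk? G m y x)
                   (λ (a , b , p) → b , a , walk-sym G m p) (λ (a , b , p) → b , a , walk-sym G m p) ⟩
      ⟦ (w ~? y) ×-dec (u ~? x) ×-dec walk? G m y x ⟧
        ≡⟨ ⟦⟧-× (w ~? y) ((u ~? x) ×-dec walk? G m y x) ⟩
      pair w u y x ∎

  -- The recurrence for W_{m+1} A multiplied by A from the left; by symmetry of W_i, entry (u, w) of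
  -- A W_i is `branches i w u`.
  neighbour-pairs-recurrence : ∀ m u w → suc m < D →
    neighbour-pairs (suc m) u w ≡ branches (suc (suc m)) w u + q *ℕ branches m w u
  neighbour-pairs-recurrence m u w m<D = begin
    neighbour-pairs (suc m) u w
      ≡⟨ sum-cong-≗ (λ x → trans (cong (⟦ u ~? x ⟧ *ℕ_) (branches-recurrence (suc m) x w m<D)) (term x)) ⟩
    sum (λ x → near x + q *ℕ nearer x)     ≡⟨ ∑-distrib-+ near (λ x → q *ℕ nearer x) ⟩
    sum near + sum (λ x → q *ℕ nearer x)   ≡⟨ cong (λ x → sum near + x) (*-distribˡ-sum q nearer) ⟨
    sum near + q *ℕ sum nearer             ∎
    where
    open ≡-Reasoning
    near nearer : Fin n → ℕ
    near   x = ⟦ (u ~? x) ×-dec walk? G (suc (suc m)) w x ⟧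
    nearer x = ⟦ (u ~? x) ×-dec walk? G m w x ⟧
    term : ∀ x → ⟦ u ~? x ⟧ *ℕ (⟦ walk? G (suc (suc m)) x w ⟧ + q *ℕ ⟦ walk? G m x w ⟧)
               ≡ near x + q *ℕ nearer x
    term x = begin
      a *ℕ (b + q *ℕ c)          ≡⟨ ℕ.*-distribˡ-+ a b (q *ℕ c) ⟩
      a *ℕ b + a *ℕ (q *ℕ c)     ≡⟨ cong (λ x → a *ℕ b + x) (trans (sym (ℕ.*-assoc a q c)) (trans (cong (_*ℕ c) (ℕ.*-comm a q)) (ℕ.*-assoc q a c))) ⟩
      a *ℕ b + q *ℕ (a *ℕ c)     ≡⟨ cong₂ (λ x y → x + q *ℕ y) (reverse (suc (suc m))) (reverse m) ⟩
      near x + q *ℕ nearer x     ∎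
      where
      a = ⟦ u ~? x ⟧
      b = ⟦ walk? G (suc (suc m)) x w ⟧
      c = ⟦ walk? G m x w ⟧
      reverse : ∀ i → ⟦ u ~? x ⟧ *ℕ ⟦ walk? G i x w ⟧ ≡ ⟦ (u ~? x) ×-dec walk? G i w x ⟧
      reverse i = trans (cong (⟦ u ~? x ⟧ *ℕ_) (⟦⟧-cong (walk? G i x w) (walk? G i w x) (walk-sym G i) (walk-sym G i)))
        (sym (⟦⟧-× (u ~? x) (walk? G i w x)))

  -- A commutes with W_m, including m = D, where `branches-recurrence` is no longer available. In A
  -- W_{m-1} A = A W_m + q A W_{m-2} the left side and the last term are symmetric, hence so is A
  -- W_m.
  branches-sym : ∀ {m} → 2 ≤ m → m ≤ D → ∀ u w → branches m u w ≡ branches m w u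
  branches-sym {suc (suc m)} (s≤s (s≤s z≤n)) m<D u w = ℕ.+-cancelʳ-≡ (q *ℕ branches m u w) _ _ (begin
    branches (suc (suc m)) u w + q *ℕ branches m u w  ≡⟨ neighbour-pairs-recurrence m w u m<D ⟨
    neighbour-pairs (suc m) w u                           ≡⟨ neighbour-pairs-sym (suc m) w u ⟩
    neighbour-pairs (suc m) u w                           ≡⟨ neighbour-pairs-recurrence m u w m<D ⟩
    branches (suc (suc m)) w u + q *ℕ branches m w u
      ≡⟨ cong (λ x → branches (suc (suc m)) w u + q *ℕ x) (branches-sym-< m w u (ℕ.<⇒≤ m<D)) ⟩
    branches (suc (suc m)) w u + q *ℕ branches m u w  ∎)
    where open ≡-Reasoning

-- Weighted sums over an eigenvector

module _ {c ℓ} (S : CommutativeSemiring c ℓ) where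
  open CommutativeSemiring S hiding (zero)
    renaming (_+_ to _⊕_; refl to ≈-refl; sym to ≈-sym; trans to ≈-trans)
  open Mult semiring using (×-homo-+; ×1-homo-*) renaming (_×_ to _·_)
  module Σ = Sum semiring
  open import Relation.Binary.Reasoning.Setoid setoid

  indic : Dec P → Carrier
  indic P? = if does P? then 1# else 0#

  ⟦⟧·1≈indic : (P? : Dec P) → ⟦ P? ⟧ · 1# ≈ indic P?
  ⟦⟧·1≈indic (yes _) = +-identityʳ 1#
  ⟦⟧·1≈indic (no _)  = ≈-refl

  sum-indic : ∀ {n} {P : Pred (Fin n) 0ℓ} (P? : Decidable P) →
              Σ.sum (λ i → indic (P? i)) ≈ count P? · 1#
  sum-indic {zero}  P? = ≈-refl
  sum-indic {suc n} P? = ≈-sym (≈-trans (×-homo-+ 1# ⟦ P? zero ⟧ _)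
    (+-cong (⟦⟧·1≈indic (P? zero)) (≈-sym (sum-indic (P? ∘ suc)))))

  sum-indic-≟ : ∀ {n} (u : Fin n) (v : Fin n → Carrier) → Σ.sum (λ i → indic (u ≟ i) * v i) ≈ v u
  sum-indic-≟ {suc n} zero v = ≈-trans
    (+-cong (*-identityˡ _) (≈-trans (Σ.sum-cong-≋ {n} (λ i → zeroˡ (v (suc i)))) (Σ.sum-replicate-zero n)))
    (+-identityʳ _)
  sum-indic-≟ {suc n} (suc u) v = ≈-trans
    (+-cong (zeroˡ _) (sum-indic-≟ u (v ∘ suc))) (+-identityˡ _)

  indic-⊎ : (P? : Dec P) (Q? : Dec Q) (R? : Dec R) →
            (P → ¬ Q) → (P → R) → (Q → R) → (R → P ⊎ Q) → indic R? ≈ indic P? ⊕ indic Q?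
  indic-⊎ (yes p) (yes q) _       ¬pq _  _  _ = contradiction q (¬pq p)
  indic-⊎ (yes p) (no _)  (yes _) _   _  _  _ = ≈-sym (+-identityʳ _)
  indic-⊎ (yes p) _       (no ¬r) _   pr _  _ = contradiction (pr p) ¬r
  indic-⊎ (no _)  (yes q) (yes _) _   _  _  _ = ≈-sym (+-identityˡ _)
  indic-⊎ (no _)  (yes q) (no ¬r) _   _  qr _ = contradiction (qr q) ¬r
  indic-⊎ (no _)  (no _)  (no _)  _   _  _  _ = ≈-sym (+-identityˡ _)
  indic-⊎ (no ¬p) (no ¬q) (yes r) _   _  _  rpq with rpq r
  ... | inj₁ p = contradiction p ¬p
  ... | inj₂ q = contradiction q ¬q

  -- Working over a commutative semiring covers two uses: the all-ones vector over the naturals,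
  -- whose weights are cardinalities, and the given eigenvector over the field.
  module Eigenvector {n} (G : SimpleGraph n) (μ : Carrier) (v : Fin n → Carrier)
    (eigen : ∀ i → Σ.sum (λ j → indic (SimpleGraph._~?_ G i j) * v j) ≈ μ * v i) where
    open SimpleGraph G

    weight : {P : Pred (Fin n) 0ℓ} → Decidable P → Carrier
    weight P? = Σ.sum λ i → indic (P? i) * v i

    -- Replace each μ v_j by the sum of v over the neighbours of j; then v_i occurs once for every
    -- neighbour of i in P.
    μ*weight : {P : Pred (Fin n) 0ℓ} (P? : Decidable P) (f : Fin n → ℕ) →
               (∀ i → count (λ j → (i ~? j) ×-dec P? j) ≡ f i) →
               μ * weight P? ≈ Σ.sum (λ i → (f i · 1#) * v i)
    μ*weight P? f counts = begin
      μ * weight P?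
        ≈⟨ Σ.*-distribˡ-sum μ (λ j → indic (P? j) * v j) ⟩
      Σ.sum (λ j → μ * (indic (P? j) * v j))
        ≈⟨ Σ.sum-cong-≋ (λ j → expand j) ⟩
      Σ.sum (λ j → Σ.sum λ i → indic ((i ~? j) ×-dec P? j) * v i)
        ≈⟨ Σ.∑-comm {n} {n} (λ j i → indic ((i ~? j) ×-dec P? j) * v i) ⟩
      Σ.sum (λ i → Σ.sum λ j → indic ((i ~? j) ×-dec P? j) * v i)
        ≈⟨ Σ.sum-cong-≋ (λ i → collect i) ⟩
      Σ.sum (λ i → (f i · 1#) * v i) ∎
      where
      merge : ∀ i j → indic (P? j) * (indic (j ~? i) * v i) ≈ indic ((i ~? j) ×-dec P? j) * v i
      merge i j with i ~? j | j ~? i | P? j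
      ... | yes _   | yes _   | yes _ = *-identityˡ _
      ... | yes _   | yes _   | no _  = ≈-trans (zeroˡ _) (≈-sym (zeroˡ _))
      ... | yes i~j | no ¬j~i | _     = contradiction (~-sym i~j) ¬j~i
      ... | no ¬i~j | yes j~i | _     = contradiction (~-sym j~i) ¬i~j
      ... | no _    | no _    | _     = ≈-trans (*-congˡ (zeroˡ _)) (≈-trans (zeroʳ _) (≈-sym (zeroˡ _)))
      expand : ∀ j → μ * (indic (P? j) * v j) ≈ Σ.sum (λ i → indic ((i ~? j) ×-dec P? j) * v i)
      expand j = begin
        μ * (indic (P? j) * v j)                                   ≈⟨ *-assoc _ _ _ ⟨
        (μ * indic (P? j)) * v j                                   ≈⟨ *-congʳ (*-comm _ _) ⟩
        (indic (P? j) * μ) * v j                                   ≈⟨ *-assoc _ _ _ ⟩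
        indic (P? j) * (μ * v j)                                   ≈⟨ *-congˡ (eigen j) ⟨
        indic (P? j) * Σ.sum (λ i → indic (j ~? i) * v i)          ≈⟨ Σ.*-distribˡ-sum (indic (P? j)) (λ i → indic (j ~? i) * v i) ⟩
        Σ.sum (λ i → indic (P? j) * (indic (j ~? i) * v i))        ≈⟨ Σ.sum-cong-≋ (λ i → merge i j) ⟩
        Σ.sum (λ i → indic ((i ~? j) ×-dec P? j) * v i)            ∎
      collect : ∀ i → Σ.sum (λ j → indic ((i ~? j) ×-dec P? j) * v i) ≈ (f i · 1#) * v i
      collect i = begin
        Σ.sum (λ j → indic ((i ~? j) ×-dec P? j) * v i)            ≈⟨ Σ.*-distribʳ-sum (v i) (λ j → indic ((i ~? j) ×-dec P? j)) ⟨
        Σ.sum (λ j → indic ((i ~? j) ×-dec P? j)) * v i            ≈⟨ *-congʳ (sum-indic (λ j → (i ~? j) ×-dec P? j)) ⟩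
        (count (λ j → (i ~? j) ×-dec P? j) · 1#) * v i             ≡⟨ cong (λ m → (m · 1#) * v i) (counts i) ⟩
        (f i · 1#) * v i                                           ∎

    weight-combination : {P Q : Pred (Fin n) 0ℓ} (P? : Decidable P) (Q? : Decidable Q) (m : ℕ) →
      Σ.sum (λ i → ((⟦ P? i ⟧ + m *ℕ ⟦ Q? i ⟧) · 1#) * v i) ≈ weight P? ⊕ (m · 1#) * weight Q?
    weight-combination P? Q? m = begin
      Σ.sum (λ i → ((⟦ P? i ⟧ + m *ℕ ⟦ Q? i ⟧) · 1#) * v i)
        ≈⟨ Σ.sum-cong-≋ (λ i → term i) ⟩
      Σ.sum (λ i → indic (P? i) * v i ⊕ (m · 1#) * (indic (Q? i) * v i))
        ≈⟨ Σ.∑-distrib-+ (λ i → indic (P? i) * v i) (λ i → (m · 1#) * (indic (Q? i) * v i)) ⟩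
      weight P? ⊕ Σ.sum (λ i → (m · 1#) * (indic (Q? i) * v i))
        ≈⟨ +-congˡ (Σ.*-distribˡ-sum (m · 1#) (λ i → indic (Q? i) * v i)) ⟨
      weight P? ⊕ (m · 1#) * weight Q? ∎
      where
      term : ∀ i → ((⟦ P? i ⟧ + m *ℕ ⟦ Q? i ⟧) · 1#) * v i
                 ≈ indic (P? i) * v i ⊕ (m · 1#) * (indic (Q? i) * v i)
      term i = begin
        ((⟦ P? i ⟧ + m *ℕ ⟦ Q? i ⟧) · 1#) * v i
          ≈⟨ *-congʳ (≈-trans (×-homo-+ 1# ⟦ P? i ⟧ _) (+-cong (⟦⟧·1≈indic (P? i))
               (≈-trans (×1-homo-* m ⟦ Q? i ⟧) (*-congˡ (⟦⟧·1≈indic (Q? i)))))) ⟩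
        (indic (P? i) ⊕ (m · 1#) * indic (Q? i)) * v i
          ≈⟨ distribʳ _ _ _ ⟩
        indic (P? i) * v i ⊕ ((m · 1#) * indic (Q? i)) * v i
          ≈⟨ +-congˡ (*-assoc _ _ _) ⟩
        indic (P? i) * v i ⊕ (m · 1#) * (indic (Q? i) * v i) ∎

    weight-⊎ : {P Q R : Pred (Fin n) 0ℓ} (P? : Decidable P) (Q? : Decidable Q) (R? : Decidable R) →
               (∀ i → P i → ¬ Q i) → (∀ i → P i → R i) → (∀ i → Q i → R i) → (∀ i → R i → P i ⊎ Q i) →
               weight R? ≈ weight P? ⊕ weight Q?
    weight-⊎ P? Q? R? ¬pq pr qr rpq = ≈-trans
      (Σ.sum-cong-≋ λ i → ≈-trans
        (*-congʳ (indic-⊎ (P? i) (Q? i) (R? i) (¬pq i) (pr i) (qr i) (rpq i)))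
        (distribʳ (v i) (indic (P? i)) (indic (Q? i))))
      (Σ.∑-distrib-+ (λ i → indic (P? i) * v i) (λ i → indic (Q? i) * v i))

    weight-none : {P : Pred (Fin n) 0ℓ} (P? : Decidable P) → (∀ i → ¬ P i) → weight P? ≈ 0#
    weight-none P? ¬P = begin
      weight P?            ≈⟨ Σ.sum-cong-≋ (λ i → term i) ⟩
      Σ.sum {n} (λ _ → 0#) ≈⟨ Σ.sum-replicate-zero n ⟩
      0#                   ∎
      where
      term : ∀ i → indic (P? i) * v i ≈ 0#
      term i with P? i
      ... | yes pᵢ = contradiction pᵢ (¬P i)
      ... | no _   = zeroˡ _

    module _ (q D : ℕ) (regular : Regular G (suc q)) (acyclic : ∀ {m} → m ≤ suc (D + D) → ¬ Cycle G m) where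
      open Regularity G q D regular acyclic

      weight-recurrence : ∀ m u → m < D →
        μ * weight (walk? G m u) ≈ weight (walk? G (suc m) u) ⊕ (q · 1#) * weight (shorterWalk? G m u)
      weight-recurrence m u m<D = ≈-trans
        (μ*weight (walk? G m u) _ (λ w → branches-recurrence m u w m<D))
        (weight-combination (walk? G (suc m) u) (shorterWalk? G m u) q)

-- Arithmetic for the sizes of walk sets

geometricSum-suc : ∀ q m → geometricSum q (suc m) ≡ 1 + q *ℕ geometricSum q m
geometricSum-suc q zero    = cong suc (sym (ℕ.*-zeroʳ q))
geometricSum-suc q (suc m) = trans (cong (λ x → x + q *ℕ q ^ m) (geometricSum-suc q m))
  (cong suc (sym (ℕ.*-distribˡ-+ q (geometricSum q m) (q ^ m))))

n×1≡n : ∀ m → Mult._×_ ℕ.+-*-semiring m 1 ≡ m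
n×1≡n zero    = refl
n×1≡n (suc m) = cong suc (n×1≡n m)

-- Girth 2(D+1) and excess 4

module Excess {n} (G : SimpleGraph n) (q D : ℕ) (2≤D : 2 ≤ D)
  (regular : Regular G (suc q)) (acyclic : ∀ {m} → m ≤ suc (D + D) → ¬ Cycle G m)
  (5≤q : 5 ≤ q) (order : n ≡ 2 *ℕ geometricSum q (suc D) + 4) where
  open SimpleGraph G
  open Girth G D acyclic
  open Regularity G q D regular acyclic

  private
    -- By regularity the all-ones vector is an eigenvector for q + 1, so the weight recurrence
    -- becomes one for cardinalities.
    degree-1 : ∀ i → sum (λ j → ⟦ i ~? j ⟧ *ℕ 1) ≡ suc q *ℕ 1
    degree-1 i = trans (sum-cong-≗ λ j → ℕ.*-identityʳ ⟦ i ~? j ⟧) (trans (valency i) (sym (ℕ.*-identityʳ (suc q))))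

    module Ones = Eigenvector ℕ.+-*-commutativeSemiring G (suc q) (λ _ → 1) degree-1

    walks : {P : Pred (Fin n) 0ℓ} (P? : Decidable P) → Ones.weight P? ≡ count P?
    walks P? = sum-cong-≗ λ i → ℕ.*-identityʳ ⟦ P? i ⟧

  ball-recurrence : ∀ m u → m < D →
    suc q *ℕ count (walk? G m u) ≡ count (walk? G (suc m) u) + q *ℕ count (shorterWalk? G m u)
  ball-recurrence m u m<D = begin
    suc q *ℕ count (walk? G m u)             ≡⟨ cong (suc q *ℕ_) (walks (walk? G m u)) ⟨
    suc q *ℕ Ones.weight (walk? G m u)       ≡⟨ Ones.weight-recurrence q D regular acyclic m u m<D ⟩
    Ones.weight (walk? G (suc m) u) + (Mult._×_ ℕ.+-*-semiring q 1) *ℕ Ones.weight (shorterWalk? G m u)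
      ≡⟨ cong₂ _+_ (walks (walk? G (suc m) u)) (cong₂ _*ℕ_ (n×1≡n q) (walks (shorterWalk? G m u))) ⟩
    count (walk? G (suc m) u) + q *ℕ count (shorterWalk? G m u) ∎
    where open ≡-Reasoning

  -- Two consecutive sizes are proved together because the recurrence has two terms.
  ball-sizes : ∀ m u → m ≤ D →
    count (walk? G m u) ≡ geometricSum q (suc m) × count (shorterWalk? G m u) ≡ geometricSum q m
  ball-sizes zero u _ =
    count-one (walk? G 0 u) u refl (λ _ → sym) , count-none (shorterWalk? G 0 u) (λ _ ())
  ball-sizes (suc m) u m<D = ℕ.+-cancelʳ-≡ (q *ℕ b) _ _ (begin
    count (walk? G (suc m) u) + q *ℕ b                          ≡⟨ cong (λ x → count (walk? G (suc m) u) + q *ℕ x) (proj₂ ih) ⟨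
    count (walk? G (suc m) u) + q *ℕ count (shorterWalk? G m u)  ≡⟨ ball-recurrence m u m<D ⟨
    suc q *ℕ count (walk? G m u)                                 ≡⟨ cong (suc q *ℕ_) (proj₁ ih) ⟩
    a + q *ℕ a                                                   ≡⟨ ℕ.+-comm a (q *ℕ a) ⟩
    q *ℕ a + a                                                   ≡⟨ cong (λ x → q *ℕ a + x) (geometricSum-suc q m) ⟩
    q *ℕ a + (1 + q *ℕ b)                                        ≡⟨ ℕ.+-suc (q *ℕ a) (q *ℕ b) ⟩
    1 + q *ℕ a + q *ℕ b                                          ≡⟨ cong (λ x → x + q *ℕ b) (geometricSum-suc q (suc m)) ⟨
    geometricSum q (suc (suc m)) + q *ℕ b                        ∎) , proj₁ ih
    where
    open ≡-Reasoning
    ih = ball-sizes m u (ℕ.<⇒≤ m<D)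
    a = geometricSum q (suc m)
    b = geometricSum q m

  outside? : ∀ x y w → Dec (¬ Walk G D x w × ¬ Walk G D y w)
  outside? x y w = ¬? (walk? G D x w) ×-dec ¬? (walk? G D y w)

  -- The sets reached in D steps from x and from y are disjoint by `not-equidistant`, and each has
  -- half the Moore bound as its size; the excess is what remains.
  outside-size : ∀ {x y} → x ~ y → count (outside? x y) ≡ 4
  outside-size {x} {y} x~y = ℕ.+-cancelˡ-≡ (2 *ℕ g) _ _ (begin
    2 *ℕ g + count (outside? x y)         ≡⟨ cong (λ i → g + i + count (outside? x y)) (ℕ.+-identityʳ g) ⟩
    g + g + count (outside? x y)          ≡⟨ ℕ.+-assoc g g _ ⟩
    g + (g + count (outside? x y))        ≡⟨ cong₂ (λ a b → a + (b + count (outside? x y))) (proj₁ (ball-sizes D x ℕ.≤-refl)) near-y ⟨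
    count (walk? G D x) + (count (λ w → ¬? (walk? G D x w) ×-dec walk? G D y w) + count (outside? x y))
                                          ≡⟨ cong (λ i → count (walk? G D x) + i) (count-split (λ w → ¬? (walk? G D x w)) (walk? G D y)) ⟨
    count (walk? G D x) + count (λ w → ¬? (walk? G D x w))
                                          ≡⟨ count-complement (walk? G D x) ⟨
    n                                     ≡⟨ order ⟩
    2 *ℕ g + 4                            ∎)
    where
    open ≡-Reasoning
    g = geometricSum q (suc D)
    near-y : count (λ w → ¬? (walk? G D x w) ×-dec walk? G D y w) ≡ g
    near-y = trans (count-cong (λ w → ¬? (walk? G D x w) ×-dec walk? G D y w) (walk? G D y) (λ _ → proj₂)
        (λ w p → (λ r → not-equidistant D ℕ.≤-refl x~y (walk-sym G D r) (walk-sym G D p)) , p))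
      (proj₁ (ball-sizes D y ℕ.≤-refl))

  near-one : ∀ {y y′} z → y ~ y′ → Walk G (suc D) z y ⊎ Walk G (suc D) z y′
  near-one {y} {y′} z y~y′ with walk? G (suc D) z y | walk? G (suc D) z y′
  ... | yes p | _      = inj₁ p
  ... | no _  | yes p  = inj₂ p
  ... | no ¬p | no ¬p′ = contradiction (begin
    suc 5                   ≤⟨ s≤s 5≤q ⟩
    suc q                   ≡⟨ valency z ⟨
    count (z ~?_)           ≤⟨ count-mono (z ~?_) (outside? y y′) (λ x z~x →
                                 (λ r → ¬p (x , z~x , walk-sym G D r)) , (λ r → ¬p′ (x , z~x , walk-sym G D r))) ⟩
    count (outside? y y′)   ≡⟨ outside-size y~y′ ⟩
    4                       ∎) λ { (s≤s (s≤s (s≤s (s≤s ())))) }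
    where open ≤-Reasoning

  away? : ∀ z y w → Dec (y ~ w × ¬ Walk G D z w)
  away? z y w = (y ~? w) ×-dec ¬? (walk? G D z w)

  branches+away : ∀ z y → branches D z y + count (away? z y) ≡ suc q
  branches+away z y = trans (sym (count-split (y ~?_) (walk? G D z))) (valency y)

  -- Let x be the first vertex after z on the walk. It reaches y in D steps, hence no neighbour of
  -- y, so the vertices counted lie outside the edge zx.
  away≤4 : ∀ {z y} → Walk G (suc D) z y → count (away? z y) ≤ 4
  away≤4 {z} {y} (x , z~x , p) = begin
    count (away? z y)       ≤⟨ count-mono (away? z y) (outside? z x)
                                 (λ w (y~w , ¬r) → ¬r , not-equidistant D ℕ.≤-refl y~w p) ⟩
    count (outside? z x)    ≡⟨ outside-size z~x ⟩
    4                       ∎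
    where open ≤-Reasoning

  2≤branches : ∀ {z y} → Walk G (suc D) z y → 2 ≤ branches D z y
  2≤branches {z} {y} p = ℕ.+-cancelʳ-≤ 4 2 _ (begin
    6                                        ≤⟨ s≤s 5≤q ⟩
    suc q                                    ≡⟨ branches+away z y ⟨
    branches D z y + count (away? z y)       ≤⟨ ℕ.+-monoʳ-≤ (branches D z y) (away≤4 p) ⟩
    branches D z y + 4                       ∎)
    where open ≤-Reasoning

  -- No neighbour of z can be at distance D from both y and y′.
  branches≤away : ∀ {y y′} z → y ~ y′ → branches D z y ≤ count (away? z y′)
  branches≤away {y} {y′} z y~y′ = ℕ.+-cancelˡ-≤ (branches D z y′) _ _ (begin
    branches D z y′ + branches D z y        ≡⟨ cong₂ _+_ (branches-sym 2≤D ℕ.≤-refl z y′) (branches-sym 2≤D ℕ.≤-refl z y) ⟩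
    branches D y′ z + branches D y z        ≤⟨ ℕ.+-monoʳ-≤ (branches D y′ z)
        (count-mono (λ x → (z ~? x) ×-dec walk? G D y x) (λ x → (z ~? x) ×-dec ¬? (walk? G D y′ x))
          (λ x (z~x , p) → z~x , λ r → not-equidistant D ℕ.≤-refl y~y′ (walk-sym G D p) (walk-sym G D r))) ⟩
    branches D y′ z + count (away? y′ z)    ≡⟨ branches+away y′ z ⟩
    suc q                                   ≡⟨ branches+away z y′ ⟨
    branches D z y′ + count (away? z y′)    ∎)
    where open ≤-Reasoning

  -- Let x be the first vertex after z on a walk to y′. The away neighbours of y′ lie outside the
  -- edge zx, and those of y other than y′ inject into the rest of the outside. By `branches≤away`
  -- the q + 1 neighbours of y number at most these two kinds plus one, so q + 1 ≤ 5.
  near-not-both : ∀ {y y′} z → y ~ y′ → Walk G (suc D) z y → ¬ Walk G (suc D) z y′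
  near-not-both {y} {y′} z y~y′ p (x , z~x , r) = contradiction (begin
    suc 5                                                    ≤⟨ s≤s 5≤q ⟩
    suc q                                                    ≡⟨ branches+away z y ⟨
    branches D z y + count (away? z y)                       ≤⟨ ℕ.+-mono-≤ (branches≤away z y~y′) away-y ⟩
    count (away? z y′) + (1 + rest)                          ≡⟨ ℕ.+-suc _ _ ⟩
    1 + (count (away? z y′) + rest)                          ≤⟨ s≤s (ℕ.+-mono-≤ away-y′ rest≤) ⟩
    1 + (count (λ w → outside? z x w ×-dec away? z y′ w) + count outside-rest?)
                                                             ≡⟨ cong suc (count-split (outside? z x) (away? z y′)) ⟨
    1 + count (outside? z x)                                 ≡⟨ cong suc (outside-size z~x) ⟩
    5                                                        ∎) λ { (s≤s (s≤s (s≤s (s≤s (s≤s ()))))) }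
    where
    open ≤-Reasoning
    others? : ∀ s → Dec ((y ~ s × ¬ Walk G D z s) × s ≢ y′)
    others? s = away? z y s ×-dec ¬? (s ≟ y′)
    outside-rest? : ∀ w → Dec ((¬ Walk G D z w × ¬ Walk G D x w) × ¬ (y′ ~ w × ¬ Walk G D z w))
    outside-rest? w = outside? z x w ×-dec ¬? (away? z y′ w)
    rest : ℕ
    rest = count others?
    away-y : count (away? z y) ≤ 1 + rest
    away-y = begin
      count (away? z y)                                      ≡⟨ count-split (away? z y) (_≟ y′) ⟩
      count (λ s → away? z y s ×-dec (s ≟ y′)) + rest        ≤⟨ ℕ.+-monoˡ-≤ rest
        (count-≤1 (λ s → away? z y s ×-dec (s ≟ y′)) λ { _ _ (_ , refl) (_ , refl) → refl }) ⟩
      1 + rest                                               ∎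
    away-y′ : count (away? z y′) ≤ count (λ w → outside? z x w ×-dec away? z y′ w)
    away-y′ = count-mono (away? z y′) (λ w → outside? z x w ×-dec away? z y′ w)
      λ w (y′~w , ¬s) → (¬s , not-equidistant D ℕ.≤-refl y′~w r) , y′~w , ¬s
    -- Each other neighbour s of y away from z contributes a vertex outside
    -- the balls around z and x: s itself, or else a neighbour of s.
    rest≤ : rest ≤ count outside-rest?
    rest≤ = count-inject others? outside-rest? (λ s w → (w ≟ s) ⊎-dec (s ~? w)) total injective
      where
      total : ∀ s → (y ~ s × ¬ Walk G D z s) × s ≢ y′ →
              ∃ λ w → ((¬ Walk G D z w × ¬ Walk G D x w) × ¬ (y′ ~ w × ¬ Walk G D z w)) × (w ≡ s ⊎ s ~ w)
      total s ((y~s , ¬zs) , s≢y′) with walk? G D x s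
      ... | no ¬xs = s , ((¬zs , ¬xs) , λ (y′~s , _) → no-triangle (ℕ.<⇒≤ 2≤D) y~y′ y~s y′~s) , inj₁ refl
      ... | yes xs =
        -- Since y has two branches, `branches≤away` along the edge ys gives s two away neighbours,
        -- one of them other than y. If it were adjacent to y′, then s and y′ would be common
        -- neighbours of w and y, forcing w = y.
        let w , (s~w , ¬zw) , w≢y = count-∃≢ (away? z s) (ℕ.≤-trans (2≤branches p) (branches≤away z y~s)) y
        in w , ((¬zw , not-equidistant D ℕ.≤-refl s~w xs) ,
                λ (y′~w , _) → w≢y (no-square 2≤D (~-sym s~w) (~-sym y′~w) s≢y′ y~s y~y′)) ,
           inj₂ s~w
      injective : ∀ s s′ w → (y ~ s × ¬ Walk G D z s) × s ≢ y′ → (y ~ s′ × ¬ Walk G D z s′) × s′ ≢ y′ →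
                  (¬ Walk G D z w × ¬ Walk G D x w) × ¬ (y′ ~ w × ¬ Walk G D z w) →
                  w ≡ s ⊎ s ~ w → w ≡ s′ ⊎ s′ ~ w → s ≡ s′
      injective s s′ w _ _ _ (inj₁ refl) (inj₁ refl) = refl
      injective s s′ w ((y~s , _) , _) ((y~s′ , _) , _) _ (inj₁ refl) (inj₂ s′~w) =
        ⊥-elim (no-triangle (ℕ.<⇒≤ 2≤D) y~s′ y~s s′~w)
      injective s s′ w ((y~s , _) , _) ((y~s′ , _) , _) _ (inj₂ s~w) (inj₁ refl) =
        ⊥-elim (no-triangle (ℕ.<⇒≤ 2≤D) y~s y~s′ s~w)
      injective s s′ w ((y~s , _) , _) ((y~s′ , _) , _) ((¬zw , _) , ¬away) (inj₂ s~w) (inj₂ s′~w) with s ≟ s′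
      ... | yes s≡s′ = s≡s′
      -- Two common neighbours s and s′ of y and w force w = y; but y is itself a neighbour of y′
      -- away from z, and those are excluded.
      ... | no  s≢s′ = contradiction
        (subst (λ a → y′ ~ a × ¬ Walk G D z a) (no-square 2≤D y~s y~s′ s≢s′ (~-sym s~w) (~-sym s′~w))
          (~-sym y~y′ , walk-parity p)) ¬away

  -- By near-one and near-not-both, having a walk of length D + 1 from u is a
  -- proper 2-colouring of G.
  count-near : ∀ u w → count (λ x → (w ~? x) ×-dec walk? G (suc D) u x) ≡
                       suc q *ℕ ⟦ ¬? (walk? G (suc D) u w) ⟧
  count-near u w with walk? G (suc D) u w
  ... | yes p = trans
    (count-none (λ x → (w ~? x) ×-dec walk? G (suc D) u x) λ x (w~x , r) → near-not-both u w~x p r)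
    (sym (ℕ.*-zeroʳ (suc q)))
  ... | no ¬p = trans
    (count-cong (λ x → (w ~? x) ×-dec walk? G (suc D) u x) (w ~?_) (λ _ → proj₁)
      λ x w~x → w~x , [ (λ p → contradiction p ¬p) , id ]′ (near-one u w~x))
    (trans (valency w) (sym (ℕ.*-identityʳ (suc q))))

  count-far : ∀ u w → count (λ x → (w ~? x) ×-dec ¬? (walk? G (suc D) u x)) ≡
                      suc q *ℕ ⟦ walk? G (suc D) u w ⟧
  count-far u w with walk? G (suc D) u w
  ... | yes p = trans
    (count-cong (λ x → (w ~? x) ×-dec ¬? (walk? G (suc D) u x)) (w ~?_) (λ _ → proj₁)
      λ x w~x → w~x , near-not-both u w~x p)
    (trans (valency w) (sym (ℕ.*-identityʳ (suc q))))
  ... | no ¬p = trans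
    (count-none (λ x → (w ~? x) ×-dec ¬? (walk? G (suc D) u x))
      λ x (w~x , ¬r) → [ ¬p , ¬r ]′ (near-one u w~x))
    (sym (ℕ.*-zeroʳ (suc q)))

  -- By `near-one` a neighbour of w is reached in D + 1 steps, hence w in D + 2. Any walk of length
  -- at most D could be lengthened to D or D + 1.
  far⇒distance : ∀ {u w} → ¬ Walk G (suc D) u w → ¬ Walk G D u w → Distance G (suc (suc D)) u w
  far⇒distance {u} {w} ¬p ¬r = walk , shorter
    where
    walk : Walk G (suc (suc D)) u w
    walk with neighbour w
    ... | x , w~x with near-one u w~x
    ...   | inj₁ p = contradiction p ¬p
    ...   | inj₂ p = walk-snoc G (suc D) p (~-sym w~x)
    shorter : ∀ {i} → i < suc (suc D) → ¬ Walk G i u w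
    shorter {i} (s≤s i≤1+D) s with ℕ.m≤n⇒m<n∨m≡n i≤1+D
    ... | inj₂ refl = ¬p s
    ... | inj₁ (s≤s i≤D) with walk-lengthen (D ∸ i) i s
    ...   | inj₁ t = ¬r (subst (λ l → Walk G l u w) (ℕ.m∸n+n≡m i≤D) t)
    ...   | inj₂ t = ¬p (subst (λ l → Walk G (suc l) u w) (ℕ.m∸n+n≡m i≤D) t)

-- Passing from eigenvectors of A to eigenvectors of E

module Spectrum {c ℓ₁ ℓ₂} (F : HeytingField c ℓ₁ ℓ₂) where
  open HeytingField F hiding (zero)
    renaming (_+_ to _⊕_; refl to ≈-refl; sym to ≈-sym; trans to ≈-trans)
  open HeytingCommutativeRing heytingCommutativeRing using (commutativeRing)
  open CommutativeRing commutativeRing using (commutativeSemiring; semiring; ring)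
  open Mult semiring using () renaming (_×_ to _·_)
  open import Algebra.Properties.Ring ring
  open import Algebra.Apartness.Properties.HeytingCommutativeRing heytingCommutativeRing using (x-0≈x)
  open import Relation.Binary.Reasoning.Setoid setoid

  #-cancel : ∀ {x y z} → x # y → (x - y) * z ≈ 0# → z ≈ 0#
  #-cancel {x} {y} {z} x#y e = let x⁻¹ , x⁻¹x≈1 , _ = #⇒invertible x#y in begin
    z                      ≈⟨ *-identityˡ z ⟨
    1# * z                 ≈⟨ *-congʳ x⁻¹x≈1 ⟨
    (x⁻¹ * (x - y)) * z    ≈⟨ *-assoc _ _ _ ⟩
    x⁻¹ * ((x - y) * z)    ≈⟨ *-congˡ e ⟩
    x⁻¹ * 0#               ≈⟨ zeroʳ _ ⟩
    0#                     ∎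

  -- The equations give (μ - κ)(μ + κ)a = 0. Cancelling needs apartness rather than mere inequality,
  -- so tightness is applied twice: to refute a # 0, and inside that to refute μ # κ.
  swap-eigenvector≈0 : ∀ {μ κ a b} → μ * a ≈ κ * b → μ * b ≈ κ * a →
                       ¬ (μ ≈ κ) → ¬ (μ ≈ - κ) → a ≈ 0#
  swap-eigenvector≈0 {μ} {κ} {a} {b} μa≈κb μb≈κa μ≉κ μ≉-κ = proj₁ (tight a 0#) λ a#0 →
    μ≉κ (proj₁ (tight μ κ) λ μ#κ → μ≉-κ (begin
      μ               ≈⟨ //-rightDividesʳ κ μ ⟨
      (μ ⊕ κ) - κ     ≈⟨ +-congʳ (#-cancel a#0 (begin
        (a - 0#) * (μ ⊕ κ) ≈⟨ *-congʳ (x-0≈x a) ⟩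
        a * (μ ⊕ κ)        ≈⟨ *-comm _ _ ⟩
        (μ ⊕ κ) * a        ≈⟨ #-cancel μ#κ difference-of-squares ⟩
        0#                 ∎)) ⟩
      0# - κ          ≈⟨ +-identityˡ _ ⟩
      - κ             ∎))
    where
    square : μ * (μ * a) ≈ κ * (κ * a)
    square = begin
      μ * (μ * a)    ≈⟨ *-congˡ μa≈κb ⟩
      μ * (κ * b)    ≈⟨ *-assoc _ _ _ ⟨
      (μ * κ) * b    ≈⟨ *-congʳ (*-comm _ _) ⟩
      (κ * μ) * b    ≈⟨ *-assoc _ _ _ ⟩
      κ * (μ * b)    ≈⟨ *-congˡ μb≈κa ⟩
      κ * (κ * a)    ∎
    mixed : μ * (κ * a) ≈ κ * (μ * a)
    mixed = ≈-trans (≈-sym (*-assoc _ _ _)) (≈-trans (*-congʳ (*-comm _ _)) (*-assoc _ _ _))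
    difference-of-squares : (μ - κ) * ((μ ⊕ κ) * a) ≈ 0#
    difference-of-squares = begin
      (μ - κ) * ((μ ⊕ κ) * a)                        ≈⟨ *-congˡ (distribʳ a μ κ) ⟩
      (μ - κ) * (μ * a ⊕ κ * a)                      ≈⟨ [y-z]x≈yx-zx _ _ _ ⟩
      μ * (μ * a ⊕ κ * a) - κ * (μ * a ⊕ κ * a)      ≈⟨ +-cong (distribˡ _ _ _) (-‿cong (distribˡ _ _ _)) ⟩
      (μ * (μ * a) ⊕ μ * (κ * a)) - (κ * (μ * a) ⊕ κ * (κ * a))
                                                     ≈⟨ +-congʳ (≈-trans (+-cong square mixed) (+-comm _ _)) ⟩
      (κ * (μ * a) ⊕ κ * (κ * a)) - (κ * (μ * a) ⊕ κ * (κ * a)) ≈⟨ -‿inverseʳ _ ⟩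
      0#                                             ∎

  H-pred : ℕ → ℕ → Carrier → Carrier
  H-pred k zero    x = 0#
  H-pred k (suc m) x = H F k m x

  H-suc : ∀ k m x → H F k (suc m) x ≈ x * H F k m x - (natural F k - 1#) * H-pred k m x
  H-suc k zero x = ≈-sym (begin
    x * 1# - (natural F k - 1#) * 0#  ≈⟨ +-cong (*-identityʳ x) (-‿cong (zeroʳ _)) ⟩
    x - 0#                            ≈⟨ x-0≈x x ⟩
    x                                 ∎)
  H-suc k (suc m) x = ≈-refl

  -- Here the valency is `suc k`, and D plays the role of d - 1.
  module _ (k D n : ℕ) (2≤D : 2 ≤ D) (5≤k : 5 ≤ k) (G : SimpleGraph n)
    (regular : Regular G (suc k)) (acyclic : ∀ {m} → m ≤ suc (D + D) → ¬ Cycle G m)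
    (order : n ≡ 2 *ℕ geometricSum k (suc D) + 4)
    (μ : Carrier) (v : Fin n → Carrier)
    (eigen : ∀ i → Sum.sum semiring (λ j → adjacencyMatrix F G i j * v j) ≈ μ * v i) where
    open Eigenvector commutativeSemiring G μ v eigen
    open Excess G k D 2≤D regular acyclic 5≤k order
    open Girth G D acyclic

    -- This is W_m = H_m(A) applied to the eigenvector: weights and `H` obey the same two-term
    -- recurrence, so two consecutive indices are carried along.
    weight-walk : ∀ m u → m ≤ D →
      (weight (walk? G m u) ≈ H F (suc k) m μ * v u) ×
      (weight (shorterWalk? G m u) ≈ H-pred (suc k) m μ * v u)
    weight-walk zero u _ =
      ≈-trans (sum-indic-≟ commutativeSemiring u v) (≈-sym (*-identityˡ _)) ,
      ≈-trans (weight-none (shorterWalk? G 0 u) λ _ ()) (≈-sym (zeroˡ _))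
    weight-walk (suc m) u m<D = (begin
      weight (walk? G (suc m) u)
        ≈⟨ //-rightDividesʳ _ _ ⟨
      (weight (walk? G (suc m) u) ⊕ (k · 1#) * shorter) - (k · 1#) * shorter
        ≈⟨ +-congʳ (weight-recurrence k D regular acyclic m u m<D) ⟨
      μ * weight (walk? G m u) - (k · 1#) * shorter
        ≈⟨ +-cong (*-congˡ (proj₁ ih)) (-‿cong (*-cong k≈ (proj₂ ih))) ⟩
      μ * (H F (suc k) m μ * v u) - (natural F (suc k) - 1#) * (H-pred (suc k) m μ * v u)
        ≈⟨ +-cong (*-assoc _ _ _) (-‿cong (*-assoc _ _ _)) ⟨
      (μ * H F (suc k) m μ) * v u - ((natural F (suc k) - 1#) * H-pred (suc k) m μ) * v u
        ≈⟨ [y-z]x≈yx-zx _ _ _ ⟨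
      (μ * H F (suc k) m μ - (natural F (suc k) - 1#) * H-pred (suc k) m μ) * v u
        ≈⟨ *-congʳ (H-suc (suc k) m μ) ⟨
      H F (suc k) (suc m) μ * v u ∎) , proj₁ ih
      where
      ih = weight-walk m u (ℕ.<⇒≤ m<D)
      shorter = weight (shorterWalk? G m u)
      k≈ : k · 1# ≈ natural F (suc k) - 1#
      k≈ = ≈-sym (≈-trans (+-congʳ (+-comm 1# (k · 1#))) (//-rightDividesʳ 1# (k · 1#)))

    far : Fin n → Carrier
    far u = weight (λ w → ¬? (walk? G (suc D) u w))

    sum-of-multiples : ∀ u {Q : Pred (Fin n) 0ℓ} (Q? : Decidable Q) →
      Sum.sum semiring (λ i → ((suc k *ℕ ⟦ Q? i ⟧) · 1#) * v i) ≈ natural F (suc k) * weight Q?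
    -- `ShorterWalk 0` is empty and fills the first slot of `weight-combination` with weight zero.
    sum-of-multiples u Q? = ≈-trans (weight-combination (shorterWalk? G 0 u) Q? (suc k))
      (≈-trans (+-congʳ (weight-none (shorterWalk? G 0 u) λ _ ())) (+-identityˡ _))

    -- Every edge joins the two colour classes, so multiplying the weight of either class by μ gives
    -- the valency times the weight of the other.
    far≈0 : ¬ (μ ≈ natural F (suc k)) → ¬ (μ ≈ - natural F (suc k)) → ∀ u → far u ≈ 0#
    far≈0 μ≉k μ≉-k u = swap-eigenvector≈0
      (≈-trans (μ*weight (λ w → ¬? (walk? G (suc D) u w)) _ (count-far u)) (sum-of-multiples u (walk? G (suc D) u)))
      (≈-trans (μ*weight (walk? G (suc D) u) _ (count-near u)) (sum-of-multiples u (λ w → ¬? (walk? G (suc D) u w))))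
      μ≉k μ≉-k

    -- Row u of H_{d-1}(A) + E: by parity the vertices reached in D steps belong to this class, and
    -- `far⇒distance` puts the others at distance D + 2 = d + 1.
    far≈ : ∀ u → far u ≈ weight (walk? G D u) ⊕ weight (distance? G (suc (suc D)) u)
    far≈ u = weight-⊎ (walk? G D u) (distance? G (suc (suc D)) u) (λ w → ¬? (walk? G (suc D) u w))
      (λ _ p (_ , ¬shorter) → ¬shorter (s≤s (ℕ.n≤1+n D)) p)
      (λ _ p r → walk-parity r p)
      (λ _ (_ , ¬shorter) → ¬shorter ℕ.≤-refl)
      (λ w ¬p → cases w ¬p (walk? G D u w))
      where
      cases : ∀ w → ¬ Walk G (suc D) u w → Dec (Walk G D u w) → Walk G D u w ⊎ Distance G (suc (suc D)) u w
      cases w ¬p (yes r) = inj₁ r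
      cases w ¬p (no ¬r) = inj₂ (far⇒distance ¬p ¬r)

    excess-eigenvector : ¬ (μ ≈ natural F (suc k)) → ¬ (μ ≈ - natural F (suc k)) → ∀ u →
      Sum.sum semiring (λ w → excessMatrix F G (suc D) u w * v w) ≈ - H F (suc k) D μ * v u
    excess-eigenvector μ≉k μ≉-k u = begin
      e                       ≈⟨ +-inverseʳ-unique _ _ (begin
        h * v u ⊕ e                   ≈⟨ +-congʳ (proj₁ (weight-walk D u ℕ.≤-refl)) ⟨
        weight (walk? G D u) ⊕ e      ≈⟨ far≈ u ⟨
        far u                         ≈⟨ far≈0 μ≉k μ≉-k u ⟩
        0#                            ∎) ⟩
      - (h * v u)             ≈⟨ -‿distribˡ-* h (v u) ⟩
      - h * v u               ∎
      where
      h = H F (suc k) D μ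
      e = weight (distance? G (suc (suc D)) u)

-- From girth 2d and excess 4 to the hypotheses in terms of D

n⊖m≡+⇒n≡m+ : ∀ n m {i} → n ⊖ m ≡ + i → n ≡ m + i
n⊖m≡+⇒n≡m+ n m {i} eq with m ℕ.≤? n
... | yes m≤n = trans (sym (ℕ.m+[n∸m]≡n m≤n)) (cong (λ x → m + x) (ℤ.+-injective (trans (sym (ℤ.⊖-≥ m≤n)) eq)))
... | no  m≰n with m ∸ n in m∸n | trans (sym (ℤ.⊖-< (ℕ.≰⇒> m≰n))) eq
...   | zero  | _  = contradiction (ℕ.m∸n≡0⇒m≤n m∸n) m≰n
...   | suc _ | ()

theorem2p4 : ∀ {c ℓ₁ ℓ₂} (F : HeytingField c ℓ₁ ℓ₂) → CharacteristicZero F →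
    let open HeytingField F in
    (k d n : ℕ) → 6 ≤ k → 6 ≤ 2 *ℕ d →
    (G : SimpleGraph n) → IsRegularOfGirth G k (2 *ℕ d) → evenExcess k d n ≡ + 4 →
    (μ : Carrier) → IsEigenvalue F (adjacencyMatrix F G) μ →
    ¬ (μ ≈ natural F k) → ¬ (μ ≈ - natural F k) →
    ∃[ lam ] (IsEigenvalue F (excessMatrix F G d) lam × H F k (d ∸ 1) μ ≈ - lam)
-- The bounds on k and 2d rule out k = 0 and d ≤ 2, which leaves D = d - 1 ≥ 2.
theorem2p4 F _ zero    d n () _ G _ _ μ _ _ _
theorem2p4 F _ (suc k) zero n _ () G _ _ μ _ _ _
theorem2p4 F _ (suc k) (suc zero) n _ (s≤s (s≤s ())) G _ _ μ _ _ _
theorem2p4 F _ (suc k) (suc (suc zero)) n _ (s≤s (s≤s (s≤s (s≤s ())))) G _ _ μ _ _ _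
theorem2p4 F _ (suc k) d@(suc (suc (suc j))) n 6≤k _ G kg excess μ (v , v≠0 , eigen) μ≉k μ≉-k =
  -- λ is - H_{d-1}(μ), with the given eigenvector of A as its eigenvector.
  - H F (suc k) D μ ,
  (v , v≠0 , excess-eigenvector k D n (s≤s (s≤s z≤n)) (ℕ.≤-pred 6≤k) G regular acyclic order μ v eigen μ≉k μ≉-k) ,
  ≈-sym (-‿involutive _)
  where
  open HeytingField F using (-_) renaming (sym to ≈-sym)
  open HeytingCommutativeRing (HeytingField.heytingCommutativeRing F) using (commutativeRing)
  open import Algebra.Properties.Ring (CommutativeRing.ring commutativeRing) using (-‿involutive)
  open Spectrum F
  open IsRegularOfGirth kg
  D = suc (suc j)
  -- Length at most 2D + 1 is the same as length below the girth 2d.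
  2+2D≡2d : suc (suc (D + D)) ≡ 2 *ℕ d
  2+2D≡2d = cong suc (trans (sym (ℕ.+-suc D D)) (cong (λ x → D + x) (sym (ℕ.+-identityʳ d))))
  acyclic : ∀ {m} → m ≤ suc (D + D) → ¬ Cycle G m
  acyclic {m} m≤ = proj₂ girth m (subst (m <_) 2+2D≡2d (s≤s m≤))
  order : n ≡ 2 *ℕ geometricSum k d + 4
  order = n⊖m≡+⇒n≡m+ n (evenMooreBound (suc k) d) excess
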